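{- Let $N\ge1$ and $W=W_N:=1+\sum_{n=1}^N\frac{P_{n-1}(y)}{x^n}\in A$. Then there are polynomials $u(y),v(y),\dots$ such that \[ W-1-\frac{y}{x}+\frac{1}{x}W+W_x+\frac{1}{x}W_y-\frac{1}{x}\log W=-\frac{P_N(y)}{x^{N+1}}+\frac{u(y)}{x^{N+2}}+\frac{v(y)}{x^{N+3}}+\cdots \]
   Context: Let $A$ be the ring of formal series $a=\sum_{n=0}^\infty \frac{q_n(y)}{x^n}$, each $q_n$ a complex polynomial of degree at most $n$, with the obvious ring operations and the $x^{ -1}$-adic topology. Formal derivatives: $a_x=-\sum_{n\ge1}\frac{n q_n(y)}{x^{n+1}}$, $a_y=\sum_{n\ge1}\frac{q_n'(y)}{x^n}$. For $1+u\in A$ with $u$ having zero constant term, $\log(1+u)=\sum_{k\ge1}(-1)^{k+1}u^k/k$. Let $V$ be the unique solution in $A$ of $V=1+\frac{y}{x}-\frac{1}{x}V-V_x-\frac{1}{x}V_y+\frac{1}{x}\log V$, and define the polynomials $P_{n-1}$ ($n\ge1$) by $V=1+\sum_{n=1}^\infty\frac{P_{n-1}(y)}{x^n}$. -}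

module Defs where

open import Algebra.Bundles using (CommutativeRing; RawRing)
open import Data.Bool.Base using (true; false; if_then_else_)
open import Data.Fin.Base using (Fin; zero; suc; toℕ)
open import Data.Fin.Properties using (toℕ≤pred[n])
import Data.Integer.Base as ℤ
open import Data.Nat.Base as ℕ using (ℕ; zero; suc)
import Data.Nat.Properties as ℕ
open import Data.Product.Base using (∃; _×_; _,_; proj₁; proj₂)
open import Data.Rational.Base as ℚ using (ℚ; 0ℚ; 1ℚ; ½; ∣_∣; Positive)
import Data.Rational.Properties as ℚ
open import Data.Rational.Solver using (module +-*-Solver)
open import Level using (0ℓ)
open import Relation.Nullary.Decidable.Core using (yes; no)
open import Relation.Binary.PropositionalEquality as ≡ using (_≡_)

-- Conversion checking unfolds the normalising operations of ℚ down to gcd computations,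
-- which is prohibitively slow; the copies below do not unfold.
opaque

  infixl 6 _⊕_
  infixl 7 _⊗_
  infix  8 ⊖_

  _⊕_ _⊗_ : ℚ → ℚ → ℚ
  _⊕_ = ℚ._+_
  _⊗_ = ℚ._*_

  ⊖_ : ℚ → ℚ
  ⊖_ = ℚ.-_

Cauchy : (ℕ → ℚ) → Set
Cauchy f = ∀ ε → 0ℚ ℚ.< ε → ∃ λ M → ∀ m n → M ℕ.≤ m → M ℕ.≤ n → ∣ f m ℚ.- f n ∣ ℚ.< ε

-- The reals are Cauchy sequences of rationals, two of them being identified by _≈ʳ_
-- when their difference tends to 0.
record ℝ : Set where
  constructor mkℝ
  field
    seq    : ℕ → ℚ
    cauchy : Cauchy seq

open ℝ

infix 4 _≈ʳ_

-- A record, so that the two reals can be recovered from the type of the proof.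
record _≈ʳ_ (x y : ℝ) : Set where
  constructor mk≈ʳ
  field
    close : ∀ ε → 0ℚ ℚ.< ε → ∃ λ M → ∀ n → M ℕ.≤ n → ∣ seq x n ℚ.- seq y n ∣ ℚ.< ε

open _≈ʳ_

private

  half : ℚ → ℚ
  half ε = ½ ℚ.* ε

  half-pos : ∀ {ε} → 0ℚ ℚ.< ε → 0ℚ ℚ.< half ε
  half-pos {ε} ε>0 =
    ℚ.positive⁻¹ (half ε) {{ℚ.pos*pos⇒pos ½ ε {{ℚ.positive ε>0}}}}

  half+half : ∀ ε → half ε ℚ.+ half ε ≡ ε
  half+half ε = ≡.trans (≡.sym (ℚ.*-distribʳ-+ ε ½ ½)) (ℚ.*-identityˡ ε)

  close-+ : ∀ {ε a b c} → a ≡ b ℚ.+ c → ∣ b ∣ ℚ.< half ε → ∣ c ∣ ℚ.< half ε → ∣ a ∣ ℚ.< ε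
  close-+ {ε} {b = b} {c} ≡.refl b<ε/2 c<ε/2 = begin-strict
    ∣ b ℚ.+ c ∣       ≤⟨ ℚ.∣p+q∣≤∣p∣+∣q∣ b c ⟩
    ∣ b ∣ ℚ.+ ∣ c ∣   <⟨ ℚ.+-mono-< b<ε/2 c<ε/2 ⟩
    half ε ℚ.+ half ε ≡⟨ half+half ε ⟩
    ε                 ∎
    where open ℚ.≤-Reasoning

  close-neg : ∀ {ε a b} → a ≡ ℚ.- b → ∣ b ∣ ℚ.< ε → ∣ a ∣ ℚ.< ε
  close-neg {b = b} ≡.refl b<ε = ≡.subst (ℚ._< _) (≡.sym (ℚ.∣-p∣≡∣p∣ b)) b<ε

  close-refl : ∀ {ε} a b → a ≡ b → 0ℚ ℚ.< ε → ∣ a ℚ.- b ∣ ℚ.< ε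
  close-refl a .a ≡.refl ε>0 = ≡.subst (λ z → ∣ z ∣ ℚ.< _) (≡.sym (ℚ.+-inverseʳ a)) ε>0

  swap-eq : ∀ a b → a ℚ.- b ≡ ℚ.- (b ℚ.- a)
  swap-eq = solve 2 (λ a b → a :- b := :- (b :- a)) ≡.refl
    where open +-*-Solver

  through-eq : ∀ a b c → a ℚ.- c ≡ (a ℚ.- b) ℚ.+ (b ℚ.- c)
  through-eq = solve 3 (λ a b c → a :- c := (a :- b) :+ (b :- c)) ≡.refl
    where open +-*-Solver

  opaque
    unfolding _⊕_ _⊗_ ⊖_

    add-eq : ∀ a b c d → (a ⊕ b) ℚ.- (c ⊕ d) ≡ (a ℚ.- c) ℚ.+ (b ℚ.- d)
    add-eq = solve 4 (λ a b c d → (a :+ b) :- (c :+ d) := (a :- c) :+ (b :- d)) ≡.refl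
      where open +-*-Solver

    neg-eq : ∀ a b → (⊖ a) ℚ.- (⊖ b) ≡ ℚ.- (a ℚ.- b)
    neg-eq = solve 2 (λ a b → (:- a) :- (:- b) := :- (a :- b)) ≡.refl
      where open +-*-Solver

    mul-eq : ∀ a b c d → (a ⊗ b) ℚ.- (c ⊗ d) ≡ (a ℚ.* (b ℚ.- d)) ℚ.+ ((a ℚ.- c) ℚ.* d)
    mul-eq = solve 4 (λ a b c d → (a :* b) :- (c :* d) := (a :* (b :- d)) :+ ((a :- c) :* d)) ≡.refl
      where open +-*-Solver

    ⊕-assoc : ∀ a b c → (a ⊕ b) ⊕ c ≡ a ⊕ (b ⊕ c)
    ⊕-assoc = ℚ.+-assoc

    ⊕-comm : ∀ a b → a ⊕ b ≡ b ⊕ a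
    ⊕-comm = ℚ.+-comm

    ⊕-identityˡ : ∀ a → 0ℚ ⊕ a ≡ a
    ⊕-identityˡ = ℚ.+-identityˡ

    ⊕-identityʳ : ∀ a → a ⊕ 0ℚ ≡ a
    ⊕-identityʳ = ℚ.+-identityʳ

    ⊕-inverseˡ : ∀ a → ⊖ a ⊕ a ≡ 0ℚ
    ⊕-inverseˡ = ℚ.+-inverseˡ

    ⊕-inverseʳ : ∀ a → a ⊕ ⊖ a ≡ 0ℚ
    ⊕-inverseʳ = ℚ.+-inverseʳ

    ⊗-assoc : ∀ a b c → (a ⊗ b) ⊗ c ≡ a ⊗ (b ⊗ c)
    ⊗-assoc = ℚ.*-assoc

    ⊗-comm : ∀ a b → a ⊗ b ≡ b ⊗ a
    ⊗-comm = ℚ.*-comm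

    ⊗-identityˡ : ∀ a → 1ℚ ⊗ a ≡ a
    ⊗-identityˡ = ℚ.*-identityˡ

    ⊗-distribˡ : ∀ a b c → a ⊗ (b ⊕ c) ≡ a ⊗ b ⊕ a ⊗ c
    ⊗-distribˡ = ℚ.*-distribˡ-+

  shift-eq : ∀ a b → a ≡ (a ℚ.- b) ℚ.+ b
  shift-eq = solve 2 (λ a b → a := (a :- b) :+ b) ≡.refl
    where open +-*-Solver

  Bound : (ℕ → ℚ) → Set
  Bound f = ∃ λ B → Positive B × ∃ λ M → ∀ n → M ℕ.≤ n → ∣ f n ∣ ℚ.≤ B

  bounded : ∀ {f} → Cauchy f → Bound f
  bounded {f} c with c 1ℚ (ℚ.positive⁻¹ 1ℚ)
  ... | M , close = 1ℚ ℚ.+ ∣ f M ∣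
                  , ℚ.pos+nonNeg⇒pos 1ℚ ∣ f M ∣ {{ℚ.∣-∣-nonNeg (f M)}}
                  , M , λ n M≤n → begin
    ∣ f n ∣                         ≡⟨ ≡.cong ∣_∣ (shift-eq (f n) (f M)) ⟩
    ∣ (f n ℚ.- f M) ℚ.+ f M ∣       ≤⟨ ℚ.∣p+q∣≤∣p∣+∣q∣ (f n ℚ.- f M) (f M) ⟩
    ∣ f n ℚ.- f M ∣ ℚ.+ ∣ f M ∣     ≤⟨ ℚ.+-monoˡ-≤ ∣ f M ∣ (ℚ.<⇒≤ (close n M M≤n ℕ.≤-refl)) ⟩
    1ℚ ℚ.+ ∣ f M ∣                  ∎
    where open ℚ.≤-Reasoning

  module _ (B ε : ℚ) (B>0 : Positive B) (ε>0 : 0ℚ ℚ.< ε) where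

    private instance
      posB = B>0
      nzB  = ℚ.pos⇒nonZero B
      posInv = ℚ.1/pos⇒pos B
      nnB  = ℚ.pos⇒nonNeg B

    δ : ℚ
    δ = ℚ.1/ B ℚ.* half ε

    δ>0 : 0ℚ ℚ.< δ
    δ>0 = ℚ.positive⁻¹ δ {{ℚ.pos*pos⇒pos (ℚ.1/ B) (half ε) {{ℚ.positive (half-pos ε>0)}}}}

    Bδ : B ℚ.* δ ≡ half ε
    Bδ = ≡.trans (≡.sym (ℚ.*-assoc B (ℚ.1/ B) (half ε)))
        (≡.trans (≡.cong (ℚ._* half ε) (ℚ.*-inverseʳ B)) (ℚ.*-identityˡ (half ε)))

    small : ∀ a b → ∣ a ∣ ℚ.≤ B → ∣ b ∣ ℚ.< δ → ∣ a ℚ.* b ∣ ℚ.< half ε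
    small a b a≤B b<δ = begin-strict
      ∣ a ℚ.* b ∣       ≡⟨ ℚ.∣p*q∣≡∣p∣*∣q∣ a b ⟩
      ∣ a ∣ ℚ.* ∣ b ∣   ≤⟨ ℚ.*-monoʳ-≤-nonNeg ∣ b ∣ {{ℚ.∣-∣-nonNeg b}} a≤B ⟩
      B ℚ.* ∣ b ∣       <⟨ ℚ.*-monoʳ-<-pos B b<δ ⟩
      B ℚ.* δ           ≡⟨ Bδ ⟩
      half ε            ∎
      where open ℚ.≤-Reasoning

    close-* : ∀ a b c d → ∣ a ∣ ℚ.≤ B → ∣ d ∣ ℚ.≤ B →
              ∣ a ℚ.- c ∣ ℚ.< δ → ∣ b ℚ.- d ∣ ℚ.< δ → ∣ (a ⊗ b) ℚ.- (c ⊗ d) ∣ ℚ.< ε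
    close-* a b c d a≤B d≤B ac bd =
      close-+ (mul-eq a b c d) (small a (b ℚ.- d) a≤B bd)
        (≡.subst (λ z → ∣ z ∣ ℚ.< half ε) (ℚ.*-comm d (a ℚ.- c)) (small d (a ℚ.- c) d≤B ac))

  ≤-+ʳ : ∀ p q → Positive q → p ℚ.≤ p ℚ.+ q
  ≤-+ʳ p q q>0 = ≡.subst (ℚ._≤ p ℚ.+ q) (ℚ.+-identityʳ p)
    (ℚ.+-monoʳ-≤ p (ℚ.<⇒≤ (ℚ.positive⁻¹ q {{q>0}})))

  bound₂ : ∀ {f g} → Bound f → Bound g →
           ∃ λ B → Positive B × ∃ λ M → ∀ n → M ℕ.≤ n → (∣ f n ∣ ℚ.≤ B) × (∣ g n ∣ ℚ.≤ B)
  bound₂ {f} {g} (B , B>0 , M , p) (C , C>0 , N , q) =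
    B ℚ.+ C
    , ℚ.pos+nonNeg⇒pos B {{B>0}} C {{ℚ.pos⇒nonNeg C {{C>0}}}}
    , M ℕ.⊔ N
    , λ n le →
        ℚ.≤-trans (p n (ℕ.≤-trans (ℕ.m≤m⊔n M N) le))
                  (≤-+ʳ B C C>0)
      , ℚ.≤-trans (q n (ℕ.≤-trans (ℕ.m≤n⊔m M N) le))
                  (≡.subst (C ℚ.≤_) (ℚ.+-comm C B) (≤-+ʳ C B B>0))

  ⊔ˡ : ∀ M N {n} → M ℕ.⊔ N ℕ.≤ n → M ℕ.≤ n
  ⊔ˡ M N = ℕ.≤-trans (ℕ.m≤m⊔n M N)

  ⊔ʳ : ∀ M N {n} → M ℕ.⊔ N ℕ.≤ n → N ℕ.≤ n
  ⊔ʳ M N = ℕ.≤-trans (ℕ.m≤n⊔m M N)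

  pointwise : ∀ x y → (∀ n → seq x n ≡ seq y n) → x ≈ʳ y
  pointwise x y eq = mk≈ʳ λ ε ε>0 → 0 , λ n _ → close-refl (seq x n) (seq y n) (eq n) ε>0

infixl 6 _+ʳ_
infixl 7 _*ʳ_
infix  8 -ʳ_

fromℚʳ : ℚ → ℝ
fromℚʳ q = mkℝ (λ _ → q) λ ε ε>0 → 0 , λ _ _ _ _ → close-refl q q ≡.refl ε>0

_+ʳ_ : ℝ → ℝ → ℝ
seq (x +ʳ y) n = seq x n ⊕ seq y n
cauchy (x +ʳ y) ε ε>0 with cauchy x (half ε) (half-pos ε>0) | cauchy y (half ε) (half-pos ε>0)
... | M , p | N , q = M ℕ.⊔ N , λ m n m≥ n≥ →
  close-+ (add-eq (seq x m) (seq y m) (seq x n) (seq y n))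
    (p m n (⊔ˡ M N m≥) (⊔ˡ M N n≥)) (q m n (⊔ʳ M N m≥) (⊔ʳ M N n≥))

-ʳ_ : ℝ → ℝ
seq (-ʳ x) n = ⊖ seq x n
cauchy (-ʳ x) ε ε>0 with cauchy x ε ε>0
... | M , p = M , λ m n m≥ n≥ → close-neg (neg-eq (seq x m) (seq x n)) (p m n m≥ n≥)

_*ʳ_ : ℝ → ℝ → ℝ
seq (x *ʳ y) n = seq x n ⊗ seq y n
cauchy (x *ʳ y) ε ε>0 with bound₂ (bounded (cauchy x)) (bounded (cauchy y))
... | B , B>0 , K , b with cauchy x (δ B ε B>0 ε>0) (δ>0 B ε B>0 ε>0)
                         | cauchy y (δ B ε B>0 ε>0) (δ>0 B ε B>0 ε>0)
... | M , p | N , q = K ℕ.⊔ (M ℕ.⊔ N) , λ m n m≥ n≥ →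
  close-* B ε B>0 ε>0 (seq x m) (seq y m) (seq x n) (seq y n)
    (proj₁ (b m (⊔ˡ K (M ℕ.⊔ N) m≥))) (proj₂ (b n (⊔ˡ K (M ℕ.⊔ N) n≥)))
    (p m n (⊔ˡ M N (⊔ʳ K (M ℕ.⊔ N) m≥)) (⊔ˡ M N (⊔ʳ K (M ℕ.⊔ N) n≥)))
    (q m n (⊔ʳ M N (⊔ʳ K (M ℕ.⊔ N) m≥)) (⊔ʳ M N (⊔ʳ K (M ℕ.⊔ N) n≥)))

private

  ≈ʳ-sym : ∀ {x y} → x ≈ʳ y → y ≈ʳ x
  ≈ʳ-sym {x} {y} (mk≈ʳ c) = mk≈ʳ λ ε ε>0 → proj₁ (c ε ε>0) , λ n n≥ →
    close-neg (swap-eq (seq y n) (seq x n)) (proj₂ (c ε ε>0) n n≥)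

  ≈ʳ-trans : ∀ {x y z} → x ≈ʳ y → y ≈ʳ z → x ≈ʳ z
  ≈ʳ-trans {x} {y} {z} (mk≈ʳ c) (mk≈ʳ d) = mk≈ʳ go
    where
    go : ∀ ε → 0ℚ ℚ.< ε → ∃ λ M → ∀ n → M ℕ.≤ n → ∣ seq x n ℚ.- seq z n ∣ ℚ.< ε
    go ε ε>0 with c (half ε) (half-pos ε>0) | d (half ε) (half-pos ε>0)
    ... | M , p | N , q = M ℕ.⊔ N , λ n n≥ →
      close-+ (through-eq (seq x n) (seq y n) (seq z n)) (p n (⊔ˡ M N n≥)) (q n (⊔ʳ M N n≥))

  +ʳ-cong : ∀ {x y u v} → x ≈ʳ y → u ≈ʳ v → x +ʳ u ≈ʳ y +ʳ v
  +ʳ-cong {x} {y} {u} {v} (mk≈ʳ c) (mk≈ʳ d) = mk≈ʳ go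
    where
    go : ∀ ε → 0ℚ ℚ.< ε → ∃ λ M → ∀ n → M ℕ.≤ n → ∣ seq (x +ʳ u) n ℚ.- seq (y +ʳ v) n ∣ ℚ.< ε
    go ε ε>0 with c (half ε) (half-pos ε>0) | d (half ε) (half-pos ε>0)
    ... | M , p | N , q = M ℕ.⊔ N , λ n n≥ →
      close-+ (add-eq (seq x n) (seq u n) (seq y n) (seq v n)) (p n (⊔ˡ M N n≥)) (q n (⊔ʳ M N n≥))

  -ʳ-cong : ∀ {x y} → x ≈ʳ y → -ʳ x ≈ʳ -ʳ y
  -ʳ-cong {x} {y} (mk≈ʳ c) = mk≈ʳ λ ε ε>0 → proj₁ (c ε ε>0) , λ n n≥ →
    close-neg (neg-eq (seq x n) (seq y n)) (proj₂ (c ε ε>0) n n≥)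

  *ʳ-cong : ∀ {x y u v} → x ≈ʳ y → u ≈ʳ v → x *ʳ u ≈ʳ y *ʳ v
  *ʳ-cong {x} {y} {u} {v} (mk≈ʳ c) (mk≈ʳ d) = mk≈ʳ go
    where
    go : ∀ ε → 0ℚ ℚ.< ε → ∃ λ M → ∀ n → M ℕ.≤ n → ∣ seq (x *ʳ u) n ℚ.- seq (y *ʳ v) n ∣ ℚ.< ε
    go ε ε>0 with bound₂ (bounded (cauchy x)) (bounded (cauchy v))
    ... | B , B>0 , K , b with c (δ B ε B>0 ε>0) (δ>0 B ε B>0 ε>0)
                             | d (δ B ε B>0 ε>0) (δ>0 B ε B>0 ε>0)
    ... | M , p | N , q = K ℕ.⊔ (M ℕ.⊔ N) , λ n n≥ →
      close-* B ε B>0 ε>0 (seq x n) (seq u n) (seq y n) (seq v n)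
        (proj₁ (b n (⊔ˡ K (M ℕ.⊔ N) n≥))) (proj₂ (b n (⊔ˡ K (M ℕ.⊔ N) n≥)))
        (p n (⊔ˡ M N (⊔ʳ K (M ℕ.⊔ N) n≥)))
        (q n (⊔ʳ M N (⊔ʳ K (M ℕ.⊔ N) n≥)))

private

  0ʳ 1ʳ : ℝ
  0ʳ = fromℚʳ 0ℚ
  1ʳ = fromℚʳ 1ℚ

  +ʳ-assoc : ∀ x y z → (x +ʳ y) +ʳ z ≈ʳ x +ʳ (y +ʳ z)
  +ʳ-assoc x y z = pointwise ((x +ʳ y) +ʳ z) (x +ʳ (y +ʳ z)) λ n → ⊕-assoc (seq x n) (seq y n) (seq z n)

  +ʳ-identityˡ : ∀ x → 0ʳ +ʳ x ≈ʳ x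
  +ʳ-identityˡ x = pointwise (0ʳ +ʳ x) x λ n → ⊕-identityˡ (seq x n)

  +ʳ-identityʳ : ∀ x → x +ʳ 0ʳ ≈ʳ x
  +ʳ-identityʳ x = pointwise (x +ʳ 0ʳ) x λ n → ⊕-identityʳ (seq x n)

  +ʳ-inverseˡ : ∀ x → (-ʳ x) +ʳ x ≈ʳ 0ʳ
  +ʳ-inverseˡ x = pointwise ((-ʳ x) +ʳ x) 0ʳ λ n → ⊕-inverseˡ (seq x n)

  +ʳ-inverseʳ : ∀ x → x +ʳ (-ʳ x) ≈ʳ 0ʳ
  +ʳ-inverseʳ x = pointwise (x +ʳ (-ʳ x)) 0ʳ λ n → ⊕-inverseʳ (seq x n)

  +ʳ-comm : ∀ x y → x +ʳ y ≈ʳ y +ʳ x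
  +ʳ-comm x y = pointwise (x +ʳ y) (y +ʳ x) λ n → ⊕-comm (seq x n) (seq y n)

  *ʳ-assoc : ∀ x y z → (x *ʳ y) *ʳ z ≈ʳ x *ʳ (y *ʳ z)
  *ʳ-assoc x y z = pointwise ((x *ʳ y) *ʳ z) (x *ʳ (y *ʳ z)) λ n → ⊗-assoc (seq x n) (seq y n) (seq z n)

  *ʳ-identityˡ : ∀ x → 1ʳ *ʳ x ≈ʳ x
  *ʳ-identityˡ x = pointwise (1ʳ *ʳ x) x λ n → ⊗-identityˡ (seq x n)

  *ʳ-comm : ∀ x y → x *ʳ y ≈ʳ y *ʳ x
  *ʳ-comm x y = pointwise (x *ʳ y) (y *ʳ x) λ n → ⊗-comm (seq x n) (seq y n)

  *ʳ-distribˡ : ∀ x y z → x *ʳ (y +ʳ z) ≈ʳ x *ʳ y +ʳ x *ʳ z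
  *ʳ-distribˡ x y z = pointwise (x *ʳ (y +ʳ z)) (x *ʳ y +ʳ x *ʳ z) λ n → ⊗-distribˡ (seq x n) (seq y n) (seq z n)

  *ʳ-identityʳ : ∀ x → x *ʳ 1ʳ ≈ʳ x
  *ʳ-identityʳ x = ≈ʳ-trans (*ʳ-comm x 1ʳ) (*ʳ-identityˡ x)

  *ʳ-distribʳ : ∀ x y z → (y +ʳ z) *ʳ x ≈ʳ y *ʳ x +ʳ z *ʳ x
  *ʳ-distribʳ x y z = ≈ʳ-trans (*ʳ-comm (y +ʳ z) x)
    (≈ʳ-trans (*ʳ-distribˡ x y z) (+ʳ-cong (*ʳ-comm x y) (*ʳ-comm x z)))

  ≈ʳ-refl : ∀ {x} → x ≈ʳ x
  ≈ʳ-refl {x} = pointwise x x λ _ → ≡.refl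

ℝ-commutativeRing : CommutativeRing 0ℓ 0ℓ
ℝ-commutativeRing = record
  { Carrier = ℝ
  ; _≈_ = _≈ʳ_
  ; _+_ = _+ʳ_
  ; _*_ = _*ʳ_
  ; -_  = -ʳ_
  ; 0#  = 0ʳ
  ; 1#  = 1ʳ
  ; isCommutativeRing = record
    { isRing = record
      { +-isAbelianGroup = record
        { isGroup = record
          { isMonoid = record
            { isSemigroup = record
              { isMagma = record
                { isEquivalence = record
                  { refl  = ≈ʳ-refl
                  ; sym   = ≈ʳ-sym
                  ; trans = ≈ʳ-trans
                  }
                ; ∙-cong = +ʳ-cong
                }
              ; assoc = +ʳ-assoc
              }
            ; identity = +ʳ-identityˡ , +ʳ-identityʳ
            }
          ; inverse = +ʳ-inverseˡ , +ʳ-inverseʳ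
          ; ⁻¹-cong = -ʳ-cong
          }
        ; comm = +ʳ-comm
        }
      ; *-cong = *ʳ-cong
      ; *-assoc = *ʳ-assoc
      ; *-identity = *ʳ-identityˡ , *ʳ-identityʳ
      ; distrib = *ʳ-distribˡ , *ʳ-distribʳ
      }
    ; *-comm = *ʳ-comm
    }
  }

module Complexification (R : CommutativeRing 0ℓ 0ℓ) where

  private
    module R = CommutativeRing R
    open R using (_≈_; _+_; _*_; -_; 0#; 1#; setoid)
    open import Relation.Binary.Reasoning.Setoid setoid
    open import Algebra.Properties.Ring R.ring using (-1*x≈-x)
    open import Algebra.Solver.Ring.NaturalCoefficients.Default R.commutativeSemiring

  record Complex : Set where
    constructor _+i_
    field
      re im : R.Carrier

  open Complex public

  infix 4 _≈ᶜ_

  record _≈ᶜ_ (z w : Complex) : Set where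
    constructor mk≈ᶜ
    field
      re≈ : re z ≈ re w
      im≈ : im z ≈ im w

  open _≈ᶜ_ public

  infixl 6 _+ᶜ_
  infixl 7 _*ᶜ_
  infix  8 -ᶜ_

  _+ᶜ_ : Complex → Complex → Complex
  z +ᶜ w = (re z + re w) +i (im z + im w)

  -ᶜ_ : Complex → Complex
  -ᶜ z = (- re z) +i (- im z)

  _*ᶜ_ : Complex → Complex → Complex
  z *ᶜ w = (re z * re w + - (im z * im w)) +i (re z * im w + im z * re w)

  fromReal : R.Carrier → Complex
  fromReal x = x +i 0#

  private

    0ᶜ 1ᶜ : Complex
    0ᶜ = fromReal 0#
    1ᶜ = fromReal 1#

    ≈ᶜ-refl : ∀ {z} → z ≈ᶜ z
    ≈ᶜ-refl = mk≈ᶜ R.refl R.refl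

    ≈ᶜ-sym : ∀ {z w} → z ≈ᶜ w → w ≈ᶜ z
    ≈ᶜ-sym (mk≈ᶜ p q) = mk≈ᶜ (R.sym p) (R.sym q)

    ≈ᶜ-trans : ∀ {z w u} → z ≈ᶜ w → w ≈ᶜ u → z ≈ᶜ u
    ≈ᶜ-trans (mk≈ᶜ p q) (mk≈ᶜ r s) = mk≈ᶜ (R.trans p r) (R.trans q s)

    +ᶜ-cong : ∀ {z w u v} → z ≈ᶜ w → u ≈ᶜ v → z +ᶜ u ≈ᶜ w +ᶜ v
    +ᶜ-cong (mk≈ᶜ p q) (mk≈ᶜ r s) = mk≈ᶜ (R.+-cong p r) (R.+-cong q s)

    +ᶜ-assoc : ∀ z w u → (z +ᶜ w) +ᶜ u ≈ᶜ z +ᶜ (w +ᶜ u)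
    +ᶜ-assoc z w u = mk≈ᶜ (R.+-assoc _ _ _) (R.+-assoc _ _ _)

    +ᶜ-identityˡ : ∀ z → 0ᶜ +ᶜ z ≈ᶜ z
    +ᶜ-identityˡ z = mk≈ᶜ (R.+-identityˡ _) (R.+-identityˡ _)

    +ᶜ-identityʳ : ∀ z → z +ᶜ 0ᶜ ≈ᶜ z
    +ᶜ-identityʳ z = mk≈ᶜ (R.+-identityʳ _) (R.+-identityʳ _)

    +ᶜ-inverseˡ : ∀ z → -ᶜ z +ᶜ z ≈ᶜ 0ᶜ
    +ᶜ-inverseˡ z = mk≈ᶜ (R.-‿inverseˡ _) (R.-‿inverseˡ _)

    +ᶜ-inverseʳ : ∀ z → z +ᶜ -ᶜ z ≈ᶜ 0ᶜ
    +ᶜ-inverseʳ z = mk≈ᶜ (R.-‿inverseʳ _) (R.-‿inverseʳ _)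

    +ᶜ-comm : ∀ z w → z +ᶜ w ≈ᶜ w +ᶜ z
    +ᶜ-comm z w = mk≈ᶜ (R.+-comm _ _) (R.+-comm _ _)

    -ᶜ-cong : ∀ {z w} → z ≈ᶜ w → -ᶜ z ≈ᶜ -ᶜ w
    -ᶜ-cong (mk≈ᶜ p q) = mk≈ᶜ (R.-‿cong p) (R.-‿cong q)

    *ᶜ-cong : ∀ {z w u v} → z ≈ᶜ w → u ≈ᶜ v → z *ᶜ u ≈ᶜ w *ᶜ v
    *ᶜ-cong (mk≈ᶜ p q) (mk≈ᶜ r s) = mk≈ᶜ
      (R.+-cong (R.*-cong p r) (R.-‿cong (R.*-cong q s)))
      (R.+-cong (R.*-cong p s) (R.*-cong q r))

    m : R.Carrier
    m = - 1#

    -- Writing negation as multiplication by m makes the semiring solver applicable.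
    neg : ∀ x → - x ≈ m * x
    neg x = R.sym (-1*x≈-x x)

    *ᶜ-assoc : ∀ z w u → (z *ᶜ w) *ᶜ u ≈ᶜ z *ᶜ (w *ᶜ u)
    *ᶜ-assoc (a +i b) (c +i d) (e +i f) = mk≈ᶜ
      (begin
        (a * c + - (b * d)) * e + - ((a * d + b * c) * f)
          ≈⟨ R.+-cong (R.*-congʳ (R.+-congˡ (neg _))) (neg _) ⟩
        (a * c + m * (b * d)) * e + m * ((a * d + b * c) * f)
          ≈⟨ solve 7 (λ m a b c d e f →
               (a :* c :+ m :* (b :* d)) :* e :+ m :* ((a :* d :+ b :* c) :* f)
               := a :* (c :* e :+ m :* (d :* f)) :+ m :* (b :* (c :* f :+ d :* e)))
               R.refl m a b c d e f ⟩
        a * (c * e + m * (d * f)) + m * (b * (c * f + d * e))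
          ≈⟨ R.+-cong (R.*-congˡ (R.+-congˡ (neg _))) (neg _) ⟨
        a * (c * e + - (d * f)) + - (b * (c * f + d * e)) ∎)
      (begin
        (a * c + - (b * d)) * f + (a * d + b * c) * e
          ≈⟨ R.+-congʳ (R.*-congʳ (R.+-congˡ (neg _))) ⟩
        (a * c + m * (b * d)) * f + (a * d + b * c) * e
          ≈⟨ solve 7 (λ m a b c d e f →
               (a :* c :+ m :* (b :* d)) :* f :+ (a :* d :+ b :* c) :* e
               := a :* (c :* f :+ d :* e) :+ b :* (c :* e :+ m :* (d :* f)))
               R.refl m a b c d e f ⟩
        a * (c * f + d * e) + b * (c * e + m * (d * f))
          ≈⟨ R.+-congˡ (R.*-congˡ (R.+-congˡ (neg _))) ⟨
        a * (c * f + d * e) + b * (c * e + - (d * f)) ∎)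

    *ᶜ-comm : ∀ z w → z *ᶜ w ≈ᶜ w *ᶜ z
    *ᶜ-comm z w = mk≈ᶜ
      (R.+-cong (R.*-comm _ _) (R.-‿cong (R.*-comm _ _)))
      (R.trans (R.+-comm _ _) (R.+-cong (R.*-comm _ _) (R.*-comm _ _)))

    *ᶜ-identityˡ : ∀ z → 1ᶜ *ᶜ z ≈ᶜ z
    *ᶜ-identityˡ (a +i b) = mk≈ᶜ
      (begin
        1# * a + - (0# * b)
          ≈⟨ R.+-congˡ (neg _) ⟩
        1# * a + m * (0# * b)
          ≈⟨ solve 3 (λ m a b → con 1 :* a :+ m :* (con 0 :* b) := a) R.refl m a b ⟩
        a ∎)
      (solve 2 (λ a b → con 1 :* b :+ con 0 :* a := b) R.refl a b)

    *ᶜ-identityʳ : ∀ z → z *ᶜ 1ᶜ ≈ᶜ z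
    *ᶜ-identityʳ z = ≈ᶜ-trans (*ᶜ-comm z 1ᶜ) (*ᶜ-identityˡ z)

    *ᶜ-distribˡ : ∀ z w u → z *ᶜ (w +ᶜ u) ≈ᶜ z *ᶜ w +ᶜ z *ᶜ u
    *ᶜ-distribˡ (a +i b) (c +i d) (e +i f) = mk≈ᶜ
      (begin
        a * (c + e) + - (b * (d + f))
          ≈⟨ R.+-congˡ (neg _) ⟩
        a * (c + e) + m * (b * (d + f))
          ≈⟨ solve 7 (λ m a b c d e f →
               a :* (c :+ e) :+ m :* (b :* (d :+ f))
               := (a :* c :+ m :* (b :* d)) :+ (a :* e :+ m :* (b :* f)))
               R.refl m a b c d e f ⟩
        (a * c + m * (b * d)) + (a * e + m * (b * f))
          ≈⟨ R.+-cong (R.+-congˡ (neg _)) (R.+-congˡ (neg _)) ⟨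
        (a * c + - (b * d)) + (a * e + - (b * f)) ∎)
      (solve 6 (λ a b c d e f →
         a :* (d :+ f) :+ b :* (c :+ e) := (a :* d :+ b :* c) :+ (a :* f :+ b :* e))
         R.refl a b c d e f)

    *ᶜ-distribʳ : ∀ z w u → (w +ᶜ u) *ᶜ z ≈ᶜ w *ᶜ z +ᶜ u *ᶜ z
    *ᶜ-distribʳ z w u = ≈ᶜ-trans (*ᶜ-comm (w +ᶜ u) z)
      (≈ᶜ-trans (*ᶜ-distribˡ z w u) (+ᶜ-cong (*ᶜ-comm z w) (*ᶜ-comm z u)))

  commutativeRing : CommutativeRing 0ℓ 0ℓ
  commutativeRing = record
    { Carrier = Complex
    ; _≈_ = _≈ᶜ_
    ; _+_ = _+ᶜ_
    ; _*_ = _*ᶜ_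
    ; -_  = -ᶜ_
    ; 0#  = 0ᶜ
    ; 1#  = 1ᶜ
    ; isCommutativeRing = record
      { isRing = record
        { +-isAbelianGroup = record
          { isGroup = record
            { isMonoid = record
              { isSemigroup = record
                { isMagma = record
                  { isEquivalence = record
                    { refl  = ≈ᶜ-refl
                    ; sym   = ≈ᶜ-sym
                    ; trans = ≈ᶜ-trans
                    }
                  ; ∙-cong = +ᶜ-cong
                  }
                ; assoc = +ᶜ-assoc
                }
              ; identity = +ᶜ-identityˡ , +ᶜ-identityʳ
              }
            ; inverse = +ᶜ-inverseˡ , +ᶜ-inverseʳ
            ; ⁻¹-cong = -ᶜ-cong
            }
          ; comm = +ᶜ-comm
          }
        ; *-cong = *ᶜ-cong
        ; *-assoc = *ᶜ-assoc
        ; *-identity = *ᶜ-identityˡ , *ᶜ-identityʳ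
        ; distrib = *ᶜ-distribˡ , *ᶜ-distribʳ
        }
      ; *-comm = *ᶜ-comm
      }
    }

-- Opaque: otherwise comparing two complex numbers may unfold them to Cauchy sequences
-- and compare the Cauchy proofs.
opaque

  ℂ-commutativeRing : CommutativeRing 0ℓ 0ℓ
  ℂ-commutativeRing = Complexification.commutativeRing ℝ-commutativeRing

module ℂ where
  open CommutativeRing ℂ-commutativeRing public
  open import Algebra.Definitions.RawMonoid +-rawMonoid public using (sum) renaming (_×_ to _·_)
  open import Algebra.Definitions.RawSemiring (RawRing.rawSemiring rawRing) public using (_^_)
  open import Algebra.Properties.Monoid.Sum +-monoid public using (sum-cong-≋; sum-replicate-zero)
  open import Algebra.Properties.Group +-group public using (ε⁻¹≈ε)

ℂ : Set
ℂ = ℂ.Carrier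

opaque
  unfolding ℂ-commutativeRing

  fromℚ : ℚ → ℂ
  fromℚ q = Complexification.fromReal ℝ-commutativeRing (fromℚʳ q)

DegreeAtMost : ℕ → (ℕ → ℂ) → Set
DegreeAtMost n f = ∀ k → n ℕ.< k → f k ℂ.≈ ℂ.0#

private

  DegreeAtMost-≤ : ∀ {m n f} → m ℕ.≤ n → DegreeAtMost m f → DegreeAtMost n f
  DegreeAtMost-≤ m≤n d k n<k = d k (ℕ.≤-<-trans m≤n n<k)

  sum-zero : ∀ {n} (f : Fin n → ℂ) → (∀ i → f i ℂ.≈ ℂ.0#) → ℂ.sum f ℂ.≈ ℂ.0#
  sum-zero {n} f f≈0 = ℂ.trans (ℂ.sum-cong-≋ f≈0) (ℂ.sum-replicate-zero n)

  ·-zero : ∀ n {x} → x ℂ.≈ ℂ.0# → n ℂ.· x ℂ.≈ ℂ.0#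
  ·-zero zero    x≈0 = ℂ.refl
  ·-zero (suc n) x≈0 = ℂ.trans (ℂ.+-cong x≈0 (·-zero n x≈0)) (ℂ.+-identityˡ ℂ.0#)

  *-zeroˡ : ∀ {x y} → x ℂ.≈ ℂ.0# → x ℂ.* y ℂ.≈ ℂ.0#
  *-zeroˡ {y = y} x≈0 = ℂ.trans (ℂ.*-congʳ x≈0) (ℂ.zeroˡ y)

  *-zeroʳ : ∀ {x y} → y ℂ.≈ ℂ.0# → x ℂ.* y ℂ.≈ ℂ.0#
  *-zeroʳ {x} y≈0 = ℂ.trans (ℂ.*-congˡ y≈0) (ℂ.zeroʳ x)

convolution : (ℕ → ℂ) → (ℕ → ℂ) → ℕ → ℂ
convolution f g k = ℂ.sum {suc k} λ i → f (toℕ i) ℂ.* g (k ℕ.∸ toℕ i)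

convolution-degree : ∀ {m n f g} → DegreeAtMost m f → DegreeAtMost n g →
                     DegreeAtMost (m ℕ.+ n) (convolution f g)
convolution-degree {m} {n} {f} {g} df dg k m+n<k = sum-zero term λ i → term≈0 (toℕ i)
  where
  term : Fin (suc k) → ℂ
  term i = f (toℕ i) ℂ.* g (k ℕ.∸ toℕ i)

  term≈0 : ∀ i → f i ℂ.* g (k ℕ.∸ i) ℂ.≈ ℂ.0#
  term≈0 i with i ℕ.≤? m
  ... | no  i≰m = *-zeroˡ (df i (ℕ.≰⇒> i≰m))
  ... | yes i≤m = *-zeroʳ (dg (k ℕ.∸ i) (ℕ.m+n≤o⇒m≤o∸n (suc n) (begin
    suc n ℕ.+ i   ≤⟨ ℕ.+-monoʳ-≤ (suc n) i≤m ⟩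
    suc (n ℕ.+ m) ≡⟨ ≡.cong suc (ℕ.+-comm n m) ⟩
    suc (m ℕ.+ n) ≤⟨ m+n<k ⟩
    k             ∎)))
    where open ℕ.≤-Reasoning

-- coeff k is the coefficient of yᵏ.
record Polynomial : Set where
  no-eta-equality
  field
    coeff  : ℕ → ℂ
    bound  : ℕ
    degree : DegreeAtMost bound coeff

module Poly = Polynomial

infix 4 _≈ₚ_

record _≈ₚ_ (p q : Polynomial) : Set where
  constructor mk≈ₚ
  field
    coeff≈ : ∀ k → Poly.coeff p k ℂ.≈ Poly.coeff q k

open _≈ₚ_ public

constant : ℂ → Polynomial
Poly.coeff  (constant c) zero    = c
Poly.coeff  (constant c) (suc _) = ℂ.0#
Poly.bound  (constant c) = 0
Poly.degree (constant c) (suc _) _ = ℂ.refl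

infixl 6 _+ₚ_
infixl 7 _*ₚ_ _·ₚ_ _•ₚ_
infix  8 -ₚ_

0ₚ 1ₚ Y : Polynomial
0ₚ = constant ℂ.0#
1ₚ = constant ℂ.1#
Poly.coeff  Y 1 = ℂ.1#
Poly.coeff  Y _ = ℂ.0#
Poly.bound  Y = 1
Poly.degree Y (suc (suc _)) _ = ℂ.refl
Poly.degree Y (suc zero) (ℕ.s≤s ())

private

  +-degree : ∀ {n f g} → DegreeAtMost n f → DegreeAtMost n g → DegreeAtMost n (λ k → f k ℂ.+ g k)
  +-degree df dg k n<k = ℂ.trans (ℂ.+-cong (df k n<k) (dg k n<k)) (ℂ.+-identityˡ ℂ.0#)

  neg-degree : ∀ {n f} → DegreeAtMost n f → DegreeAtMost n (λ k → ℂ.- f k)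
  neg-degree df k n<k = ℂ.trans (ℂ.-‿cong (df k n<k)) ℂ.ε⁻¹≈ε

  ·-degree : ∀ {n f} m → DegreeAtMost n f → DegreeAtMost n (λ k → m ℂ.· f k)
  ·-degree m df k n<k = ·-zero m (df k n<k)

  •-degree : ∀ {n f} c → DegreeAtMost n f → DegreeAtMost n (λ k → c ℂ.* f k)
  •-degree c df k n<k = *-zeroʳ (df k n<k)

  ′-degree : ∀ {n f} → DegreeAtMost n f → DegreeAtMost n (λ k → suc k ℂ.· f (suc k))
  ′-degree df k n<k = ·-zero (suc k) (df (suc k) (ℕ.m<n⇒m<1+n n<k))

_+ₚ_ : Polynomial → Polynomial → Polynomial
Poly.coeff  (p +ₚ q) k = Poly.coeff p k ℂ.+ Poly.coeff q k
Poly.bound  (p +ₚ q) = Poly.bound p ℕ.⊔ Poly.bound q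
Poly.degree (p +ₚ q) = +-degree
  (DegreeAtMost-≤ (ℕ.m≤m⊔n (Poly.bound p) (Poly.bound q)) (Poly.degree p))
  (DegreeAtMost-≤ (ℕ.m≤n⊔m (Poly.bound p) (Poly.bound q)) (Poly.degree q))

-ₚ_ : Polynomial → Polynomial
Poly.coeff  (-ₚ p) k = ℂ.- Poly.coeff p k
Poly.bound  (-ₚ p) = Poly.bound p
Poly.degree (-ₚ p) = neg-degree (Poly.degree p)

_*ₚ_ : Polynomial → Polynomial → Polynomial
Poly.coeff  (p *ₚ q) = convolution (Poly.coeff p) (Poly.coeff q)
Poly.bound  (p *ₚ q) = Poly.bound p ℕ.+ Poly.bound q
Poly.degree (p *ₚ q) = convolution-degree (Poly.degree p) (Poly.degree q)

_·ₚ_ : ℕ → Polynomial → Polynomial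
Poly.coeff  (n ·ₚ p) k = n ℂ.· Poly.coeff p k
Poly.bound  (n ·ₚ p) = Poly.bound p
Poly.degree (n ·ₚ p) = ·-degree n (Poly.degree p)

_•ₚ_ : ℂ → Polynomial → Polynomial
Poly.coeff  (c •ₚ p) k = c ℂ.* Poly.coeff p k
Poly.bound  (c •ₚ p) = Poly.bound p
Poly.degree (c •ₚ p) = •-degree c (Poly.degree p)

_′ : Polynomial → Polynomial
Poly.coeff  (p ′) k = suc k ℂ.· Poly.coeff p (suc k)
Poly.bound  (p ′) = Poly.bound p
Poly.degree (p ′) = ′-degree (Poly.degree p)

polynomial-rawRing : RawRing 0ℓ 0ℓ
polynomial-rawRing = record
  { Carrier = Polynomial
  ; _≈_ = _≈ₚ_
  ; _+_ = _+ₚ_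
  ; _*_ = _*ₚ_
  ; -_  = -ₚ_
  ; 0#  = 0ₚ
  ; 1#  = 1ₚ
  }

open import Algebra.Definitions.RawMonoid (RawRing.+-rawMonoid polynomial-rawRing) public
  using () renaming (sum to sumₚ)

sumₚ-degree : ∀ {m n} (f : Fin n → Polynomial) → (∀ i → DegreeAtMost m (Poly.coeff (f i))) →
              DegreeAtMost m (Poly.coeff (sumₚ f))
sumₚ-degree {n = zero}  f df (suc k) _ = ℂ.refl
sumₚ-degree {n = suc n} f df = +-degree (df zero) (sumₚ-degree (λ i → f (suc i)) (λ i → df (suc i)))

-- Formal series Σₙ qₙ(y)/xⁿ with arbitrary polynomial coefficients.
Series : Set
Series = ℕ → Polynomial

infix 4 _≈ˢ_

_≈ˢ_ : Series → Series → Set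
s ≈ˢ t = ∀ n → s n ≈ₚ t n

-- Multiplication by x⁻ᵐ.
_/x^_ : Series → ℕ → Series
(s /x^ zero)  n       = s n
(s /x^ suc m) zero    = 0ₚ
(s /x^ suc m) (suc n) = (s /x^ m) n

infixr 5 _∷ˢ_

-- p ∷ˢ s is p + s/x.
_∷ˢ_ : Polynomial → Series → Series
(p ∷ˢ s) zero    = p
(p ∷ˢ s) (suc n) = s n

-- coeff n is the coefficient qₙ(y) of x⁻ⁿ.
record A : Set where
  no-eta-equality
  field
    coeff  : Series
    degree : ∀ n → DegreeAtMost n (Poly.coeff (coeff n))

open A public

infix  4 _≈_
infixl 6 _+_ _-_
infixl 7 _*_ _•_
infix  8 -_

_≈_ : A → A → Set
a ≈ b = coeff a ≈ˢ coeff b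

_+_ : A → A → A
coeff  (a + b) n = coeff a n +ₚ coeff b n
degree (a + b) n = +-degree (degree a n) (degree b n)

-_ : A → A
coeff  (- a) n = -ₚ coeff a n
degree (- a) n = neg-degree (degree a n)

_-_ : A → A → A
a - b = a + - b

_*_ : A → A → A
coeff  (a * b) n = sumₚ {suc n} λ i → coeff a (toℕ i) *ₚ coeff b (n ℕ.∸ toℕ i)
degree (a * b) n = sumₚ-degree {n} {suc n} (λ i → coeff a (toℕ i) *ₚ coeff b (n ℕ.∸ toℕ i)) λ i →
  ≡.subst (λ m → DegreeAtMost m (Poly.coeff (coeff a (toℕ i) *ₚ coeff b (n ℕ.∸ toℕ i))))
    (ℕ.m+[n∸m]≡n (toℕ≤pred[n] i))
    (convolution-degree (degree a (toℕ i)) (degree b (n ℕ.∸ toℕ i)))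

_•_ : ℂ → A → A
coeff  (c • a) n = c •ₚ coeff a n
degree (c • a) n = •-degree c (degree a n)

0# 1# 1/x y/x : A

coeff  0# _ = 0ₚ
degree 0# _ (suc _) _ = ℂ.refl

coeff  1# zero    = 1ₚ
coeff  1# (suc _) = 0ₚ
degree 1# zero    (suc _) _ = ℂ.refl
degree 1# (suc _) (suc _) _ = ℂ.refl

coeff  1/x 1 = 1ₚ
coeff  1/x _ = 0ₚ
degree 1/x zero          (suc _) _ = ℂ.refl
degree 1/x (suc zero)    (suc _) _ = ℂ.refl
degree 1/x (suc (suc _)) (suc _) _ = ℂ.refl

coeff  y/x 1 = Y
coeff  y/x _ = 0ₚ
degree y/x zero          (suc _) _ = ℂ.refl
degree y/x (suc zero)              = Poly.degree Y
degree y/x (suc (suc _)) (suc _) _ = ℂ.refl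

A-rawRing : RawRing 0ℓ 0ℓ
A-rawRing = record
  { Carrier = A
  ; _≈_ = _≈_
  ; _+_ = _+_
  ; _*_ = _*_
  ; -_  = -_
  ; 0#  = 0#
  ; 1#  = 1#
  }

open import Algebra.Definitions.RawSemiring (RawRing.rawSemiring A-rawRing) public
  using (_^_; sum)

∂x : A → A
coeff  (∂x a) zero    = 0ₚ
coeff  (∂x a) (suc n) = -ₚ (n ·ₚ coeff a n)
degree (∂x a) zero    (suc _) _ = ℂ.refl
degree (∂x a) (suc n) = DegreeAtMost-≤ (ℕ.n≤1+n n) (neg-degree (·-degree n (degree a n)))

∂y : A → A
coeff  (∂y a) n = coeff a n ′
degree (∂y a) n = ′-degree (degree a n)

-- Convergence of a sequence in the x⁻¹-adic topology.
_⟶_ : (ℕ → A) → A → Set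
s ⟶ a = ∀ n → ∃ λ M → ∀ m → M ℕ.≤ m → ∀ i → i ℕ.≤ n → coeff (s m) i ≈ₚ coeff a i

HasConstantTermOne : A → Set
HasConstantTermOne a = coeff a 0 ≈ₚ 1ₚ

-- The term (-1)ᵏ⁺¹uᵏ/k with k = j + 1.
logTerm : A → ℕ → A
logTerm u j = ((ℂ.- ℂ.1#) ℂ.^ (k ℕ.+ 1) ℂ.* fromℚ (ℤ.+ 1 ℚ./ k)) • u ^ k
  where
  k : ℕ
  k = suc j

-- Since u = a - 1 has no constant term, uᵏ has no terms below x⁻ᵏ, so that only k ≤ n
-- contribute to the coefficient of x⁻ⁿ; log-converges shows that this is the x⁻¹-adic sum.
log : (a : A) → HasConstantTermOne a → A
coeff  (log a _) n = sumₚ {n} λ j → coeff (logTerm (a - 1#) (toℕ j)) n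
degree (log a _) n = sumₚ-degree {n} {n} (λ j → coeff (logTerm (a - 1#) (toℕ j)) n) λ j →
  degree (logTerm (a - 1#) (toℕ j)) n

private

  IsZero : Polynomial → Set
  IsZero p = ∀ k → Poly.coeff p k ℂ.≈ ℂ.0#

  sumₚ-coeff : ∀ {n} (f : Fin n → Polynomial) k →
               Poly.coeff (sumₚ f) k ℂ.≈ ℂ.sum (λ i → Poly.coeff (f i) k)
  sumₚ-coeff {zero}  f zero    = ℂ.refl
  sumₚ-coeff {zero}  f (suc k) = ℂ.refl
  sumₚ-coeff {suc n} f k       = ℂ.+-congˡ (sumₚ-coeff (λ i → f (suc i)) k)

  sum-coeff : ∀ {n} (f : Fin n → A) i k →
              Poly.coeff (coeff (sum f) i) k ℂ.≈ ℂ.sum (λ j → Poly.coeff (coeff (f j) i) k)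
  sum-coeff {zero}  f i zero    = ℂ.refl
  sum-coeff {zero}  f i (suc k) = ℂ.refl
  sum-coeff {suc n} f i k       = ℂ.+-congˡ (sum-coeff (λ j → f (suc j)) i k)

  sum-truncate : ∀ {n m} → n ℕ.≤ m → (g : ℕ → ℂ) → (∀ j → n ℕ.≤ j → g j ℂ.≈ ℂ.0#) →
                 ℂ.sum {m} (λ j → g (toℕ j)) ℂ.≈ ℂ.sum {n} (λ j → g (toℕ j))
  sum-truncate {m = m} ℕ.z≤n g g≈0 = sum-zero {m} (λ j → g (toℕ j)) λ j → g≈0 (toℕ j) ℕ.z≤n
  sum-truncate (ℕ.s≤s n≤m) g g≈0 =
    ℂ.+-congˡ (sum-truncate n≤m (λ j → g (suc j)) λ j n≤j → g≈0 (suc j) (ℕ.s≤s n≤j))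

  *ₚ-zeroˡ : ∀ {p q} → IsZero p → IsZero (p *ₚ q)
  *ₚ-zeroˡ {p} {q} p≈0 k =
    sum-zero {suc k} (λ i → Poly.coeff p (toℕ i) ℂ.* Poly.coeff q (k ℕ.∸ toℕ i)) λ i → *-zeroˡ (p≈0 (toℕ i))

  *ₚ-zeroʳ : ∀ {p q} → IsZero q → IsZero (p *ₚ q)
  *ₚ-zeroʳ {p} {q} q≈0 k =
    sum-zero {suc k} (λ i → Poly.coeff p (toℕ i) ℂ.* Poly.coeff q (k ℕ.∸ toℕ i)) λ i → *-zeroʳ (q≈0 (k ℕ.∸ toℕ i))

  ^-order : ∀ {u} → IsZero (coeff u 0) → ∀ k n → n ℕ.< k → IsZero (coeff (u ^ k) n)
  ^-order {u} u₀≈0 (suc k) n (ℕ.s≤s n≤k) l = ℂ.trans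
    (sumₚ-coeff {suc n} (λ i → term (toℕ i)) l)
    (sum-zero {suc n} (λ i → Poly.coeff (term (toℕ i)) l) λ i → term≈0 (toℕ i) (toℕ≤pred[n] i) l)
    where
    term : ℕ → Polynomial
    term i = coeff u i *ₚ coeff (u ^ k) (n ℕ.∸ i)

    term≈0 : ∀ i → i ℕ.≤ n → IsZero (term i)
    term≈0 zero    _   = *ₚ-zeroˡ {coeff u 0} {coeff (u ^ k) n} u₀≈0
    term≈0 (suc i) i<n = *ₚ-zeroʳ {coeff u (suc i)} {coeff (u ^ k) (n ℕ.∸ suc i)}
      (^-order {u} u₀≈0 k (n ℕ.∸ suc i) (ℕ.<-≤-trans (ℕ.∸-monoʳ-< ℕ.z<s i<n) n≤k))

log-converges : ∀ a (a₀ : HasConstantTermOne a) →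
                (λ m → sum {m} λ j → logTerm (a - 1#) (toℕ j)) ⟶ log a a₀
log-converges a a₀ n = n , λ m n≤m i i≤n → mk≈ₚ λ k → ℂ.trans
  (sum-coeff {m} (λ j → logTerm (a - 1#) (toℕ j)) i k)
  (ℂ.trans
    (sum-truncate (ℕ.≤-trans i≤n n≤m) (λ j → Poly.coeff (coeff (logTerm (a - 1#) j) i) k)
      λ j i≤j → *-zeroʳ (^-order {a - 1#} u₀≈0 (suc j) i (ℕ.s≤s i≤j) k))
    (ℂ.sym (sumₚ-coeff {i} (λ j → coeff (logTerm (a - 1#) (toℕ j)) i) k)))
  where
  u₀≈0 : IsZero (coeff (a - 1#) 0)
  u₀≈0 k = ℂ.trans (ℂ.+-congʳ (coeff≈ a₀ k)) (ℂ.-‿inverseʳ (Poly.coeff 1ₚ k))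

record IsSolution (V : A) : Set where
  field
    constantTerm : HasConstantTermOne V
    equation     : V ≈ 1# + y/x - 1/x * V - ∂x V - 1/x * ∂y V + 1/x * log V constantTerm

-- P V n is the polynomial Pₙ, the coefficient of x⁻⁽ⁿ⁺¹⁾ in V.
P : A → ℕ → Polynomial
P V n = coeff V (suc n)

W : A → ℕ → A
coeff  (W V N) zero    = 1ₚ
coeff  (W V N) (suc n) = if n ℕ.<ᵇ N then P V n else 0ₚ
degree (W V N) zero    (suc _) _ = ℂ.refl
degree (W V N) (suc n) with n ℕ.<ᵇ N
... | true  = degree V (suc n)
... | false = degree 0# (suc n)

W-constantTerm : ∀ V N → HasConstantTermOne (W V N)
W-constantTerm V N = mk≈ₚ λ _ → ℂ.refl

{-# OPTIONS --safe #-}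

-- The equation has the form V = E(V), where the coefficient of x⁻ⁿ in E(a) only involves
-- the coefficients of a below x⁻ⁿ. As W agrees with V below x⁻⁽ᴺ⁺¹⁾, in degrees n ≤ N + 1 the
-- left-hand side W - E(W) has the same coefficients as W - E(V) = W - V = -P_N/x⁽ᴺ⁺¹⁾ - ⋯.
module Submission where

open import Data.Nat.Base using (ℕ; suc; _≤_)
open import Data.Product.Base using (∃)
open import Defs

open import Algebra.Properties.AbelianGroup ℂ.+-abelianGroup using (⁻¹-∙-comm; ⁻¹-involutive)
open import Data.Bool.Base using (T; true; false)
open import Data.Fin.Base using (Fin; zero; suc; toℕ)
open import Data.Fin.Properties using (toℕ<n; toℕ≤pred[n])
import Data.Nat.Base as ℕ
import Data.Nat.Properties as ℕ
open import Data.Product.Base using (_,_)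
open import Data.Unit.Base using (tt)
open import Relation.Binary.PropositionalEquality as ≡ using (_≡_)
open import Relation.Nullary.Negation using (contradiction)

≈ₚ-refl : ∀ {p} → p ≈ₚ p
≈ₚ-refl = mk≈ₚ λ _ → ℂ.refl

≈ₚ-sym : ∀ {p q} → p ≈ₚ q → q ≈ₚ p
≈ₚ-sym p≈q = mk≈ₚ λ k → ℂ.sym (coeff≈ p≈q k)

≈ₚ-trans : ∀ {p q r} → p ≈ₚ q → q ≈ₚ r → p ≈ₚ r
≈ₚ-trans p≈q q≈r = mk≈ₚ λ k → ℂ.trans (coeff≈ p≈q k) (coeff≈ q≈r k)

+ₚ-cong : ∀ {p q r s} → p ≈ₚ q → r ≈ₚ s → p +ₚ r ≈ₚ q +ₚ s
+ₚ-cong p≈q r≈s = mk≈ₚ λ k → ℂ.+-cong (coeff≈ p≈q k) (coeff≈ r≈s k)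

-ₚ-cong : ∀ {p q} → p ≈ₚ q → -ₚ p ≈ₚ -ₚ q
-ₚ-cong p≈q = mk≈ₚ λ k → ℂ.-‿cong (coeff≈ p≈q k)

*ₚ-cong : ∀ {p q r s} → p ≈ₚ q → r ≈ₚ s → p *ₚ r ≈ₚ q *ₚ s
*ₚ-cong p≈q r≈s = mk≈ₚ λ k → ℂ.sum-cong-≋ {suc k} λ i →
  ℂ.*-cong (coeff≈ p≈q (toℕ i)) (coeff≈ r≈s (k ℕ.∸ toℕ i))

•ₚ-cong : ∀ c {p q} → p ≈ₚ q → c •ₚ p ≈ₚ c •ₚ q
•ₚ-cong c p≈q = mk≈ₚ λ k → ℂ.*-congˡ (coeff≈ p≈q k)

·-cong : ∀ n {x y} → x ℂ.≈ y → n ℂ.· x ℂ.≈ n ℂ.· y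
·-cong ℕ.zero  x≈y = ℂ.refl
·-cong (suc n) x≈y = ℂ.+-cong x≈y (·-cong n x≈y)

·ₚ-cong : ∀ n {p q} → p ≈ₚ q → n ·ₚ p ≈ₚ n ·ₚ q
·ₚ-cong n p≈q = mk≈ₚ λ k → ·-cong n (coeff≈ p≈q k)

′-cong : ∀ {p q} → p ≈ₚ q → p ′ ≈ₚ q ′
′-cong p≈q = mk≈ₚ λ k → ·-cong (suc k) (coeff≈ p≈q (suc k))

sumₚ-cong : ∀ {n} {f g : Fin n → Polynomial} → (∀ i → f i ≈ₚ g i) → sumₚ f ≈ₚ sumₚ g
sumₚ-cong {ℕ.zero} f≈g = ≈ₚ-refl
sumₚ-cong {suc n}  f≈g = +ₚ-cong (f≈g zero) (sumₚ-cong λ i → f≈g (suc i))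

*ₚ-zeroˡ : ∀ p → 0ₚ *ₚ p ≈ₚ 0ₚ
*ₚ-zeroˡ p = mk≈ₚ λ k → ℂ.trans
  (ℂ.sum-cong-≋ {suc k} λ i → ℂ.trans (ℂ.*-congʳ (coeff-0ₚ (toℕ i))) (ℂ.zeroˡ (Poly.coeff p (k ℕ.∸ toℕ i))))
  (ℂ.trans (ℂ.sum-replicate-zero (suc k)) (ℂ.sym (coeff-0ₚ k)))
  where
  coeff-0ₚ : ∀ k → Poly.coeff 0ₚ k ℂ.≈ ℂ.0#
  coeff-0ₚ ℕ.zero  = ℂ.refl
  coeff-0ₚ (suc _) = ℂ.refl

-- Congruence modulo x⁻ⁿ. The bound is strict, so an operator that gains one degree turns agreement
-- below `n` into equality at `n` itself.
AgreeBelow : ℕ → A → A → Set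
AgreeBelow n a b = ∀ i → i ℕ.< n → coeff a i ≈ₚ coeff b i

AgreeBelow-≤ : ∀ {m n} a b → m ≤ n → AgreeBelow n a b → AgreeBelow m a b
AgreeBelow-≤ a b m≤n a≈b i i<m = a≈b i (ℕ.<-≤-trans i<m m≤n)

*-agree : ∀ {n} a b c d → AgreeBelow n a b → AgreeBelow n c d → AgreeBelow n (a * c) (b * d)
*-agree a b c d a≈b c≈d i i<n = sumₚ-cong {suc i} λ j → *ₚ-cong
  (a≈b (toℕ j) (ℕ.≤-<-trans (toℕ≤pred[n] j) i<n))
  (c≈d (i ℕ.∸ toℕ j) (ℕ.≤-<-trans (ℕ.m∸n≤m i (toℕ j)) i<n))

^-agree : ∀ {n} a b → AgreeBelow n a b → ∀ k → AgreeBelow n (a ^ k) (b ^ k)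
^-agree a b a≈b ℕ.zero  i i<n = ≈ₚ-refl
^-agree a b a≈b (suc k) = *-agree a b (a ^ k) (b ^ k) a≈b (^-agree a b a≈b k)

-- In degree `i` both logarithms are cut off after the same `i` terms, so the powers can be compared
-- term by term.
log-agree : ∀ {n} a b a₀ b₀ → AgreeBelow n a b → AgreeBelow n (log a a₀) (log b b₀)
log-agree a b _ _ a≈b i i<n = sumₚ-cong {i} λ j → •ₚ-cong _
  (^-agree (a - 1#) (b - 1#) (λ l l<n → +ₚ-cong (a≈b l l<n) ≈ₚ-refl) (suc (toℕ j)) i i<n)

∂y-agree : ∀ {n} a b → AgreeBelow n a b → AgreeBelow n (∂y a) (∂y b)
∂y-agree a b a≈b i i<n = ′-cong (a≈b i i<n)

1/x*-agree : ∀ {n} a b → AgreeBelow n a b → coeff (1/x * a) n ≈ₚ coeff (1/x * b) n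
1/x*-agree {n} a b a≈b = +ₚ-cong
  -- The only summand with the uncontrolled coefficient at `n` is multiplied by the constant term
  -- `0ₚ` of `1/x`.
  (≈ₚ-trans (*ₚ-zeroˡ (coeff a n)) (≈ₚ-sym (*ₚ-zeroˡ (coeff b n))))
  (sumₚ-cong {n} λ j → *ₚ-cong (≈ₚ-refl {coeff 1/x (suc (toℕ j))})
    (a≈b (n ℕ.∸ suc (toℕ j)) (ℕ.∸-monoʳ-< ℕ.z<s (toℕ<n j))))

-- Differentiating x⁻ⁿ gives a multiple of x⁻⁽ⁿ⁺¹⁾, so `∂x` gains a degree without a factor `1/x`.
∂x-agree : ∀ {n} a b → AgreeBelow n a b → coeff (∂x a) n ≈ₚ coeff (∂x b) n
∂x-agree {ℕ.zero} a b a≈b = ≈ₚ-refl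
∂x-agree {suc n}  a b a≈b = -ₚ-cong (·ₚ-cong n (a≈b n ℕ.≤-refl))

-- The operator `E`, whose fixed points are the solutions.
rhs : (a : A) → HasConstantTermOne a → A
rhs a a₀ = 1# + y/x - 1/x * a - ∂x a - 1/x * ∂y a + 1/x * log a a₀

-- Apart from the fixed part `1# + y/x`, the argument occurs only under `∂x` or a factor `1/x`, each
-- of which gains one degree.
rhs-agree : ∀ {n} a b a₀ b₀ → AgreeBelow n a b → coeff (rhs a a₀) n ≈ₚ coeff (rhs b b₀) n
rhs-agree a b a₀ b₀ a≈b =
  +ₚ-cong
    (+ₚ-cong
      (+ₚ-cong
        (+ₚ-cong ≈ₚ-refl (-ₚ-cong (1/x*-agree a b a≈b)))
        (-ₚ-cong (∂x-agree a b a≈b)))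
      (-ₚ-cong (1/x*-agree (∂y a) (∂y b) (∂y-agree a b a≈b))))
    (1/x*-agree (log a a₀) (log b b₀) (log-agree a b a₀ b₀ a≈b))

residual : (a : A) → HasConstantTermOne a → A
residual a a₀ = a - 1# - y/x + 1/x * a + ∂x a + 1/x * ∂y a - 1/x * log a a₀

residual≈a-rhs : ∀ a a₀ → residual a a₀ ≈ a - rhs a a₀
-- Each call strips the last summand from both sides, from the logarithm down to `y/x`, until
-- `a - 1#` is left on both.
residual≈a-rhs a a₀ n = mk≈ₚ λ k → subtract (add (add (add (subtract ℂ.refl))))
  where
  subtract : ∀ {w s t z} → w ℂ.≈ z ℂ.+ ℂ.- s → w ℂ.+ ℂ.- t ℂ.≈ z ℂ.+ ℂ.- (s ℂ.+ t)
  subtract {s = s} {t} {z} eq = ℂ.trans (ℂ.+-congʳ eq)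
    (ℂ.trans (ℂ.+-assoc z (ℂ.- s) (ℂ.- t)) (ℂ.+-congˡ (⁻¹-∙-comm s t)))

  add : ∀ {w s t z} → w ℂ.≈ z ℂ.+ ℂ.- s → w ℂ.+ t ℂ.≈ z ℂ.+ ℂ.- (s ℂ.+ ℂ.- t)
  add {t = t} eq = ℂ.trans (ℂ.+-congˡ (ℂ.sym (⁻¹-involutive t))) (subtract eq)

residual-agree : ∀ {V} (sol : IsSolution V) a a₀ {n} → AgreeBelow n a V →
                 coeff (residual a a₀) n ≈ₚ coeff (a - V) n
residual-agree {V} sol a a₀ {n} a≈V = ≈ₚ-trans (residual≈a-rhs a a₀ n)
  (+ₚ-cong ≈ₚ-refl (-ₚ-cong
    (≈ₚ-trans (rhs-agree a V a₀ constantTerm a≈V) (≈ₚ-sym (equation n)))))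
  where open IsSolution sol

W-agree : ∀ V → HasConstantTermOne V → ∀ N → AgreeBelow (suc N) (W V N) V
W-agree V V₀ N ℕ.zero  _           = ≈ₚ-sym V₀
W-agree V V₀ N (suc n) (ℕ.s≤s n<N) with n ℕ.<ᵇ N | ℕ.<⇒<ᵇ n<N
-- In the `false` case the second scrutinee would have the empty type `T false`.
... | true | _ = ≈ₚ-refl

-- The guard at index `suc N` compares `N` with itself: this is the first coefficient cut off, so
-- `W - V` has `-ₚ P V N` there.
W-tail : ∀ V N → coeff (W V N) (suc N) ≡ 0ₚ
W-tail V N with N ℕ.<ᵇ N in eq
... | false = ≡.refl
... | true  = contradiction (ℕ.<ᵇ⇒< N N (≡.subst T (≡.sym eq) tt)) (ℕ.n≮n N)

-- Induction on `m` removes the vanishing leading coefficients one at a time until `p` is at the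
-- head.
shift-out : ∀ m (s : Series) p → (∀ n → n ℕ.< m → s n ≈ₚ 0ₚ) → s m ≈ₚ p →
            s ≈ˢ (p ∷ˢ λ n → s (m ℕ.+ suc n)) /x^ m
shift-out ℕ.zero  s p s≈0 s≈p ℕ.zero  = s≈p
shift-out ℕ.zero  s p s≈0 s≈p (suc n) = ≈ₚ-refl
shift-out (suc m) s p s≈0 s≈p ℕ.zero  = s≈0 0 ℕ.z<s
shift-out (suc m) s p s≈0 s≈p (suc n) =
  shift-out m (λ i → s (suc i)) p (λ i i<m → s≈0 (suc i) (ℕ.s≤s i<m)) s≈p n

+ₚ-identityˡ : ∀ p → 0ₚ +ₚ p ≈ₚ p
+ₚ-identityˡ p = mk≈ₚ λ
  { ℕ.zero  → ℂ.+-identityˡ _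
  ; (suc _) → ℂ.+-identityˡ _
  }

-ₚ-inverseʳ : ∀ {p q} → p ≈ₚ q → p +ₚ -ₚ q ≈ₚ 0ₚ
-ₚ-inverseʳ {q = q} p≈q = mk≈ₚ λ
  { ℕ.zero  → ℂ.trans (ℂ.+-congʳ (coeff≈ p≈q 0)) (ℂ.-‿inverseʳ _)
  ; (suc k) → ℂ.trans (ℂ.+-congʳ (coeff≈ p≈q (suc k))) (ℂ.-‿inverseʳ _)
  }

theorem4p3 : (V : A) → IsSolution V → (N : ℕ) → 1 ≤ N →
    let w = W V N in
    ∃ λ (r : Series) →
    coeff (w - 1# - y/x + 1/x * w + ∂x w + 1/x * ∂y w - 1/x * log w (W-constantTerm V N))
    ≈ˢ ((-ₚ P V N) ∷ˢ r) /x^ suc N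
-- Unification takes the witness from `shift-out`: the coefficients of the residual from x⁻⁽ᴺ⁺²⁾ on.
theorem4p3 V sol N _ = _ , shift-out (suc N) (coeff (residual w w₀)) (-ₚ P V N)
  (λ n n≤N → ≈ₚ-trans
    (residual-agree sol w w₀ (AgreeBelow-≤ w V (ℕ.<⇒≤ n≤N) w≈V))
    (-ₚ-inverseʳ (w≈V n n≤N)))
  -- Agreement below `suc N` still determines the residual at `suc N`, where `w` has `0ₚ` and `V`
  -- has `P V N`.
  (≈ₚ-trans (residual-agree sol w w₀ w≈V)
    (≡.subst (λ p → p +ₚ -ₚ P V N ≈ₚ -ₚ P V N) (≡.sym (W-tail V N)) (+ₚ-identityˡ (-ₚ P V N))))
  where
  w : A
  w = W V N

  w₀ : HasConstantTermOne w
  w₀ = W-constantTerm V N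

  w≈V : AgreeBelow (suc N) w V
  w≈V = W-agree V (IsSolution.constantTerm sol) N
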